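{- Let $A$ be a simple type and let $\theta = (\theta_Q)_Q$ be a family with $\theta_Q \in D_Q(A)$ for every finite set $Q$. Then the following are equivalent: (i) $\theta$ is a profinite $\lambda$-term, i.e. for every partial surjection $f \colon Q \twoheadrightarrow Q'$ between finite sets, $(\theta_Q, \theta_{Q'}) \in [\![A]\!]_f$; (ii) $\theta$ is a parametric family, i.e. for all finite sets $Q, Q'$ and every relation $R \subseteq Q \times Q'$, $(\theta_Q, \theta_{Q'}) \in [\![A]\!]_R$.
   Context: Simple types are generated from a base type $o$ by $\Rightarrow$. $\Lambda(A)$ is the set of closed simply typed $\lambda$-terms of type $A$ modulo $\beta\eta$. For a finite set $Q$: $[\![o]\!]_Q = Q$, $[\![A\Rightarrow B]\!]_Q$ = all functions $[\![A]\!]_Q \to [\![B]\!]_Q$, and $[\![M]\!]_Q \in [\![A]\!]_Q$ is the standard interpretation of $M \in \Lambda(A)$. The set of definable elements is $D_Q(A) = \{[\![M]\!]_Q : M \in \Lambda(A)\}$. For relations $S \subseteq P \times P'$, $R \subseteq Q \times Q'$, define $S \Rightarrow R \subseteq (P \to Q) \times (P' \to Q')$ as $\{(g,h) : \forall x\,S\,y,\ g(x)\,R\,h(y)\}$. For $R \subseteq Q \times Q'$ the logical relation $[\![A]\!]_R \subseteq [\![A]\!]_Q \times [\![A]\!]_{Q'}$ is defined by $[\![o]\!]_R = R$ and $[\![A \Rightarrow B]\!]_R = [\![A]\!]_R \Rightarrow [\![B]\!]_R$. A partial surjection $f \colon Q \twoheadrightarrow Q'$ is a relation that is the graph of a partial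 function surjective onto $Q'$. -}

module Defs where

open import Data.Fin using (Fin)
open import Data.List using (List; []; _∷_)
open import Data.List.Membership.Propositional using (_∈_)
open import Data.List.Relation.Unary.Any using (here; there)
open import Data.Nat using (ℕ)
open import Data.Product using (∃; _,_)
open import Function.Base using (_∘_)
open import Function.Bundles using (Func; _⟨$⟩_; _↔_)
open import Function.Relation.Binary.Setoid.Equality using (_⇨_)
open import Level using (0ℓ; suc)
open import Relation.Binary.Bundles using (Setoid)
open import Relation.Binary.Core using (REL)
open import Relation.Binary.PropositionalEquality as ≡ using (_≡_; refl)
open import Relation.Unary using (Pred)

infixr 7 _⇒_

data Ty : Set where
  o   : Ty
  _⇒_ : Ty → Ty → Ty

Ctx : Set
Ctx = List Ty

private
  variable
    Γ Δ : Ctx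
    A B : Ty

infix  4 _⊢_
infixl 7 _·_

data _⊢_ (Γ : Ctx) : Ty → Set where
  var : A ∈ Γ → Γ ⊢ A
  lam : A ∷ Γ ⊢ B → Γ ⊢ A ⇒ B
  _·_ : Γ ⊢ A ⇒ B → Γ ⊢ A → Γ ⊢ B

Ren : Ctx → Ctx → Set
Ren Γ Δ = ∀ {A} → A ∈ Γ → A ∈ Δ

liftᵣ : Ren Γ Δ → Ren (B ∷ Γ) (B ∷ Δ)
liftᵣ r (here p)  = here p
liftᵣ r (there i) = there (r i)

rename : Ren Γ Δ → Γ ⊢ A → Δ ⊢ A
rename r (var i) = var (r i)
rename r (lam M) = lam (rename (liftᵣ r) M)
rename r (M · N) = rename r M · rename r N

weaken : Γ ⊢ A → B ∷ Γ ⊢ A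
weaken = rename there

Sub : Ctx → Ctx → Set
Sub Γ Δ = ∀ {A} → A ∈ Γ → Δ ⊢ A

liftₛ : Sub Γ Δ → Sub (B ∷ Γ) (B ∷ Δ)
liftₛ σ (here p)  = var (here p)
liftₛ σ (there i) = weaken (σ i)

subst : Sub Γ Δ → Γ ⊢ A → Δ ⊢ A
subst σ (var i) = σ i
subst σ (lam M) = lam (subst (liftₛ σ) M)
subst σ (M · N) = subst σ M · subst σ N

single : Γ ⊢ B → Sub (B ∷ Γ) Γ
single N (here refl) = N
single N (there i)   = var i

infix 8 _[_]

_[_] : B ∷ Γ ⊢ A → Γ ⊢ B → Γ ⊢ A
M [ N ] = subst (single N) M

infix 4 _≈βη_

data _≈βη_ {Γ : Ctx} : Γ ⊢ A → Γ ⊢ A → Set where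
  β        : (M : A ∷ Γ ⊢ B) (N : Γ ⊢ A) → lam M · N ≈βη M [ N ]
  η        : (M : Γ ⊢ A ⇒ B) → M ≈βη lam (weaken M · var (here refl))
  lam-cong : {M N : A ∷ Γ ⊢ B} → M ≈βη N → lam M ≈βη lam N
  ·-cong   : {M M′ : Γ ⊢ A ⇒ B} {N N′ : Γ ⊢ A} →
             M ≈βη M′ → N ≈βη N′ → M · N ≈βη M′ · N′
  ≈-refl   : {M : Γ ⊢ A} → M ≈βη M
  ≈-sym    : {M N : Γ ⊢ A} → M ≈βη N → N ≈βη M
  ≈-trans  : {M N P : Γ ⊢ A} → M ≈βη N → N ≈βη P → M ≈βη P

Λ : Ty → Setoid 0ℓ 0ℓ
Λ A = record
  { Carrier       = [] ⊢ A
  ; _≈_           = _≈βη_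
  ; isEquivalence = record { refl = ≈-refl ; sym = ≈-sym ; trans = ≈-trans }
  }

record FiniteSet : Set (suc 0ℓ) where
  field
    Elem        : Set
    size        : ℕ
    enumeration : Elem ↔ Fin size

open FiniteSet public using (Elem)

-- Elements of function types are compared pointwise, so that the set of all
-- functions is rendered, without function extensionality, as the setoid of
-- all equality-preserving functions.

⟦_⟧ : Ty → FiniteSet → Setoid 0ℓ 0ℓ
⟦ o ⟧     Q = ≡.setoid (Elem Q)
⟦ A ⇒ B ⟧ Q = ⟦ A ⟧ Q ⇨ ⟦ B ⟧ Q

⟦_⟧∙ : Ty → FiniteSet → Set
⟦ A ⟧∙ Q = Setoid.Carrier (⟦ A ⟧ Q)

module Interpretation (Q : FiniteSet) where

  private
    module ⟦⟧ (A : Ty) = Setoid (⟦ A ⟧ Q)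

  Env : Ctx → Set
  Env Γ = ∀ {A} → A ∈ Γ → ⟦ A ⟧∙ Q

  infix 4 _≈ₑ_

  _≈ₑ_ : Env Γ → Env Γ → Set
  _≈ₑ_ {Γ} ρ ρ′ = ∀ {A} (i : A ∈ Γ) → ⟦⟧._≈_ A (ρ i) (ρ′ i)

  extend : (A : Ty) → ⟦ A ⟧∙ Q → Env Γ → Env (A ∷ Γ)
  extend A x ρ (here refl) = x
  extend A x ρ (there i)   = ρ i

  extend-cong : (A : Ty) {x y : ⟦ A ⟧∙ Q} {ρ ρ′ : Env Γ} →
                ⟦⟧._≈_ A x y → ρ ≈ₑ ρ′ → extend A x ρ ≈ₑ extend A y ρ′
  extend-cong A x≈y ρ≈ρ′ (here refl) = x≈y
  extend-cong A x≈y ρ≈ρ′ (there i)   = ρ≈ρ′ i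

  eval : Γ ⊢ A → Env Γ → ⟦ A ⟧∙ Q
  eval-cong : (M : Γ ⊢ A) {ρ ρ′ : Env Γ} →
              ρ ≈ₑ ρ′ → ⟦⟧._≈_ A (eval M ρ) (eval M ρ′)

  eval (var i) ρ = ρ i
  eval (M · N) ρ = eval M ρ ⟨$⟩ eval N ρ
  eval (lam {A = A} M) ρ = record
    { to   = λ x → eval M (extend A x ρ)
    ; cong = λ x≈y → eval-cong M
               (extend-cong A {ρ = ρ} x≈y (λ {B} _ → ⟦⟧.refl B))
    }

  eval-cong (var i) ρ≈ρ′ = ρ≈ρ′ i
  eval-cong {A = B} (_·_ {A = A} M N) {ρ} {ρ′} ρ≈ρ′ = ⟦⟧.trans B
    (eval-cong M ρ≈ρ′ (eval N ρ))
    (Func.cong (eval M ρ′) (eval-cong N ρ≈ρ′))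
  eval-cong (lam {A = A} M) {ρ} ρ≈ρ′ x =
    eval-cong M (extend-cong A {ρ = ρ} (⟦⟧.refl A) ρ≈ρ′)

  eval-rename : (r : Ren Γ Δ) (M : Γ ⊢ A) (ρ : Env Δ) →
                ⟦⟧._≈_ A (eval (rename r M) ρ) (eval M (ρ ∘ r))
  eval-rename {A = A} r (var i) ρ = ⟦⟧.refl A
  eval-rename {A = B} r (M · N) ρ = ⟦⟧.trans B
    (eval-rename r M ρ (eval (rename r N) ρ))
    (Func.cong (eval M (ρ ∘ r)) (eval-rename r N ρ))
  eval-rename {A = A ⇒ B} r (lam M) ρ x = ⟦⟧.trans B
    (eval-rename (liftᵣ r) M (extend A x ρ))
    (eval-cong M λ where
      (here refl)   → ⟦⟧.refl A
      {C} (there i) → ⟦⟧.refl C)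

  eval-subst : (σ : Sub Γ Δ) (M : Γ ⊢ A) (ρ : Env Δ) →
               ⟦⟧._≈_ A (eval (subst σ M) ρ) (eval M (λ i → eval (σ i) ρ))
  eval-subst {A = A} σ (var i) ρ = ⟦⟧.refl A
  eval-subst {A = B} σ (M · N) ρ = ⟦⟧.trans B
    (eval-subst σ M ρ (eval (subst σ N) ρ))
    (Func.cong (eval M (λ i → eval (σ i) ρ)) (eval-subst σ N ρ))
  eval-subst {A = A ⇒ B} σ (lam M) ρ x = ⟦⟧.trans B
    (eval-subst (liftₛ σ) M (extend A x ρ))
    (eval-cong M λ where
      (here refl) → ⟦⟧.refl A
      (there i)   → eval-rename there (σ i) (extend A x ρ))

  eval-sound : {M N : Γ ⊢ A} → M ≈βη N → (ρ : Env Γ) →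
               ⟦⟧._≈_ A (eval M ρ) (eval N ρ)
  eval-sound {A = A} (β {A = B} M N) ρ = ⟦⟧.sym A (⟦⟧.trans A
    (eval-subst (single N) M ρ)
    (eval-cong M λ where
      (here refl)   → ⟦⟧.refl B
      {C} (there i) → ⟦⟧.refl C))
  eval-sound {A = A ⇒ B} (η M) ρ x =
    ⟦⟧.sym B (eval-rename there M (extend A x ρ) x)
  eval-sound (lam-cong {A = A} M≈N) ρ x = eval-sound M≈N (extend A x ρ)
  eval-sound {A = B} (·-cong {M′ = M′} {N = N} M≈M′ N≈N′) ρ = ⟦⟧.trans B
    (eval-sound M≈M′ ρ (eval N ρ))
    (Func.cong (eval M′ ρ) (eval-sound N≈N′ ρ))
  eval-sound {A = A} ≈-refl            ρ = ⟦⟧.refl A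
  eval-sound {A = A} (≈-sym M≈N)       ρ = ⟦⟧.sym A (eval-sound M≈N ρ)
  eval-sound {A = A} (≈-trans M≈N N≈P) ρ =
    ⟦⟧.trans A (eval-sound M≈N ρ) (eval-sound N≈P ρ)

  interpret : (A : Ty) → Func (Λ A) (⟦ A ⟧ Q)
  interpret A = record
    { to   = λ M → eval M (λ ())
    ; cong = λ M≈N → eval-sound M≈N (λ ())
    }

open Interpretation public using (interpret)

D : (Q : FiniteSet) (A : Ty) → Pred (⟦ A ⟧∙ Q) 0ℓ
D Q A x = ∃ λ (M : [] ⊢ A) → interpret Q A ⟨$⟩ M ≈ x
  where open Setoid (⟦ A ⟧ Q)

infixr 7 _⇛_

_⇛_ : {P P′ Q Q′ : Setoid 0ℓ 0ℓ} →
      REL (Setoid.Carrier P) (Setoid.Carrier P′) 0ℓ →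
      REL (Setoid.Carrier Q) (Setoid.Carrier Q′) 0ℓ →
      REL (Func P Q) (Func P′ Q′) 0ℓ
(S ⇛ R) g h = ∀ x y → S x y → R (g ⟨$⟩ x) (h ⟨$⟩ y)

⟦_⟧ᴿ : (A : Ty) {Q Q′ : FiniteSet} → REL (Elem Q) (Elem Q′) 0ℓ →
       REL (⟦ A ⟧∙ Q) (⟦ A ⟧∙ Q′) 0ℓ
⟦ o ⟧ᴿ     R = R
⟦ A ⇒ B ⟧ᴿ {Q} {Q′} R =
  _⇛_ {⟦ A ⟧ Q} {⟦ A ⟧ Q′} {⟦ B ⟧ Q} {⟦ B ⟧ Q′} (⟦ A ⟧ᴿ R) (⟦ B ⟧ᴿ R)

record IsPartialSurjection {X Y : Set} (f : REL X Y 0ℓ) : Set where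
  field
    functional : ∀ {x y y′} → f x y → f x y′ → y ≡ y′
    surjective : ∀ y → ∃ λ x → f x y

IsProfinite : (A : Ty) → ((Q : FiniteSet) → ⟦ A ⟧∙ Q) → Set (suc 0ℓ)
IsProfinite A θ =
  (Q Q′ : FiniteSet) (f : REL (Elem Q) (Elem Q′) 0ℓ) →
  IsPartialSurjection f → ⟦ A ⟧ᴿ {Q} {Q′} f (θ Q) (θ Q′)

IsParametric : (A : Ty) → ((Q : FiniteSet) → ⟦ A ⟧∙ Q) → Set (suc 0ℓ)
IsParametric A θ =
  (Q Q′ : FiniteSet) (R : REL (Elem Q) (Elem Q′) 0ℓ) →
  ⟦ A ⟧ᴿ {Q} {Q′} R (θ Q) (θ Q′)

{-# OPTIONS --safe #-}
-- If Q and Q′ are both inhabited, then P = Q × Q′ retracts onto each of them.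
-- Let M define θ_P.  A retraction P → Q lifts to a retraction ⟦A⟧_P → ⟦A⟧_Q
-- that agrees with the logical relation of its graph, so this logical relation
-- is functional; as it relates θ_P = ⟦M⟧_P to both θ_Q and ⟦M⟧_Q, it follows
-- that θ_Q = ⟦M⟧_Q.  The same M defines θ_Q′, and the fundamental lemma for M
-- gives parametricity.  If Q′ is empty, every R ⊆ Q × Q′ is already a partial
-- surjection, and if Q is empty, the converse of R is one.
module Submission where

open import Defs
open import Data.Empty using (⊥-elim)
open import Data.Fin using (zero)
open import Data.Fin.Properties using (¬Fin0; *↔×)
open import Data.List using (_∷_)
import Data.List.Membership.Propositional as List
open import Data.List.Relation.Unary.Any using (here; there)
open import Data.Nat using (zero; suc; _*_)
open import Data.Product using (_×_; _,_; proj₁; proj₂)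
open import Data.Product.Function.NonDependent.Propositional using (_×-↔_)
open import Data.Sum using (_⊎_; inj₁; inj₂)
open import Function.Base using (flip)
open import Function.Bundles using (_⇔_; _⟨$⟩_; Func; Inverse; mk⇔)
open import Function.Properties.Inverse using (↔-sym; ↔-trans)
open import Level using (0ℓ)
open import Relation.Binary.Bundles using (Setoid)
open import Relation.Binary.Core using (REL)
open import Relation.Binary.PropositionalEquality using (_≡_; refl; sym; trans; cong; subst₂)
open import Relation.Nullary using (¬_)
open import Relation.Unary using (_∈_)

open Interpretation using (Env; eval; extend)

module ⟦⟧ (Q : FiniteSet) (A : Ty) = Setoid (⟦ A ⟧ Q)

-- The case split is constructive because a `FiniteSet` carries its `size`.
inhabited⊎empty : (Q : FiniteSet) → Elem Q ⊎ ¬ Elem Q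
inhabited⊎empty record { size = zero  ; enumeration = e } =
  inj₂ λ q → ¬Fin0 (Inverse.to e q)
inhabited⊎empty record { size = suc _ ; enumeration = e } =
  inj₁ (Inverse.from e zero)

infixr 6 _×ᶠ_

_×ᶠ_ : FiniteSet → FiniteSet → FiniteSet
P ×ᶠ Q = record
  { Elem        = Elem P × Elem Q
  ; size        = P.size * Q.size
  ; enumeration = ↔-trans (P.enumeration ×-↔ Q.enumeration) (↔-sym *↔×)
  }
  where
  module P = FiniteSet P
  module Q = FiniteSet Q

module _ {Q Q′ : FiniteSet} (R : REL (Elem Q) (Elem Q′) 0ℓ) where

  ⟦⟧ᴿ-resp-≈ : (A : Ty) {x x′ : ⟦ A ⟧∙ Q} {y y′ : ⟦ A ⟧∙ Q′} →
               ⟦⟧._≈_ Q A x x′ → ⟦⟧._≈_ Q′ A y y′ →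
               ⟦ A ⟧ᴿ {Q} {Q′} R x y → ⟦ A ⟧ᴿ {Q} {Q′} R x′ y′
  ⟦⟧ᴿ-resp-≈ o       x≈x′ y≈y′ xRy         = subst₂ R x≈x′ y≈y′ xRy
  ⟦⟧ᴿ-resp-≈ (A ⇒ B) g≈g′ h≈h′ gRh x y xRy =
    ⟦⟧ᴿ-resp-≈ B (g≈g′ x) (h≈h′ y) (gRh x y xRy)

  -- The fundamental lemma of logical relations, stated for open terms in related environments so
  -- that the induction passes under `lam`.
  eval-⟦⟧ᴿ : ∀ {Γ A} (M : Γ ⊢ A) (ρ : Env Q Γ) (ρ′ : Env Q′ Γ) →
             (∀ {B} (i : B List.∈ Γ) → ⟦ B ⟧ᴿ {Q} {Q′} R (ρ i) (ρ′ i)) →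
             ⟦ A ⟧ᴿ {Q} {Q′} R (eval Q M ρ) (eval Q′ M ρ′)
  eval-⟦⟧ᴿ (var i) ρ ρ′ ρRρ′ = ρRρ′ i
  eval-⟦⟧ᴿ (M · N) ρ ρ′ ρRρ′ =
    eval-⟦⟧ᴿ M ρ ρ′ ρRρ′ _ _ (eval-⟦⟧ᴿ N ρ ρ′ ρRρ′)
  eval-⟦⟧ᴿ {Γ} (lam {A = A} M) ρ ρ′ ρRρ′ x y xRy =
    eval-⟦⟧ᴿ M (extend Q A x ρ) (extend Q′ A y ρ′) extended
    where
    extended : ∀ {B} (i : B List.∈ A ∷ Γ) →
               ⟦ B ⟧ᴿ {Q} {Q′} R (extend Q A x ρ i) (extend Q′ A y ρ′ i)
    extended (here refl) = xRy
    extended (there i)   = ρRρ′ i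

  interpret-⟦⟧ᴿ : (A : Ty) (M : Setoid.Carrier (Λ A)) →
                  ⟦ A ⟧ᴿ {Q} {Q′} R (interpret Q A ⟨$⟩ M) (interpret Q′ A ⟨$⟩ M)
  interpret-⟦⟧ᴿ A M = eval-⟦⟧ᴿ M _ _ λ ()

⟦⟧ᴿ-flip : (A : Ty) {Q Q′ : FiniteSet} {R : REL (Elem Q) (Elem Q′) 0ℓ}
           {x : ⟦ A ⟧∙ Q} {y : ⟦ A ⟧∙ Q′} →
           ⟦ A ⟧ᴿ {Q} {Q′} R x y → ⟦ A ⟧ᴿ {Q′} {Q} (flip R) y x
⟦⟧ᴿ-flip o                xRy         = xRy
⟦⟧ᴿ-flip (A ⇒ B) {Q} {Q′} gRh y x yRx =
  ⟦⟧ᴿ-flip B {Q} {Q′} (gRh x y (⟦⟧ᴿ-flip A {Q′} {Q} yRx))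

-- Both conditions quantify over elements of `Y`, hence hold vacuously.
into-empty-isPartialSurjection : {X Y : Set} → ¬ Y → (R : REL X Y 0ℓ) →
                                 IsPartialSurjection R
into-empty-isPartialSurjection ¬Y R = record
  { functional = λ {_} {y} → ⊥-elim (¬Y y)
  ; surjective = λ y → ⊥-elim (¬Y y)
  }

module Retraction {P Q : FiniteSet}
                  (r : Elem P → Elem Q) (s : Elem Q → Elem P)
                  (r∘s≡id : ∀ q → r (s q) ≡ q) where

  Graph : REL (Elem P) (Elem Q) 0ℓ
  Graph p q = r p ≡ q

  graph-isPartialSurjection : IsPartialSurjection Graph
  graph-isPartialSurjection = record
    { functional = λ rp≡q rp≡q′ → trans (sym rp≡q) rp≡q′
    ; surjective = λ q → s q , r∘s≡id q
    }

  retract : (A : Ty) → Func (⟦ A ⟧ P) (⟦ A ⟧ Q)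
  section : (A : Ty) → Func (⟦ A ⟧ Q) (⟦ A ⟧ P)

  retract o       = record { to = r ; cong = cong r }
  retract (A ⇒ B) = record
    { to   = λ g → record
      { to   = λ y → retract B ⟨$⟩ (g ⟨$⟩ (section A ⟨$⟩ y))
      ; cong = λ y≈y′ →
          Func.cong (retract B) (Func.cong g (Func.cong (section A) y≈y′))
      }
    ; cong = λ g≈g′ y → Func.cong (retract B) (g≈g′ (section A ⟨$⟩ y))
    }

  section o       = record { to = s ; cong = cong s }
  section (A ⇒ B) = record
    { to   = λ h → record
      { to   = λ x → section B ⟨$⟩ (h ⟨$⟩ (retract A ⟨$⟩ x))
      ; cong = λ x≈x′ →
          Func.cong (section B) (Func.cong h (Func.cong (retract A) x≈x′))
      }
    ; cong = λ h≈h′ x → Func.cong (section B) (h≈h′ (retract A ⟨$⟩ x))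
    }

  -- Proved by mutual induction, since at an arrow type each statement needs the other at the
  -- domain. The converse of `related⇒retract` can fail at arrow types: `retract` tests a function
  -- only on the image of `section`.
  section-related : (A : Ty) (y : ⟦ A ⟧∙ Q) →
                    ⟦ A ⟧ᴿ {P} {Q} Graph (section A ⟨$⟩ y) y
  related⇒retract : (A : Ty) {x : ⟦ A ⟧∙ P} {y : ⟦ A ⟧∙ Q} →
                    ⟦ A ⟧ᴿ {P} {Q} Graph x y → ⟦⟧._≈_ Q A (retract A ⟨$⟩ x) y

  section-related o       y         = r∘s≡id y
  section-related (A ⇒ B) h x y xRy =
    -- The induction hypothesis at `B` yields the value of `h` at `retract A ⟨$⟩ x`, which `xRy`
    -- identifies with its value at `y`.
    ⟦⟧ᴿ-resp-≈ {P} {Q} Graph B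
      (⟦⟧.refl P B)
      (Func.cong h (related⇒retract A xRy))
      (section-related B (h ⟨$⟩ (retract A ⟨$⟩ x)))

  related⇒retract o       xRy   = xRy
  related⇒retract (A ⇒ B) gRh y =
    related⇒retract B (gRh (section A ⟨$⟩ y) y (section-related A y))

  -- Definability alone may give a different term for each set; this carries the term chosen at `P`
  -- over to its retract `Q`.
  profinite-definable : (A : Ty) (θ : (Q : FiniteSet) → ⟦ A ⟧∙ Q) →
                        IsProfinite A θ → (M : Setoid.Carrier (Λ A)) →
                        ⟦⟧._≈_ P A (interpret P A ⟨$⟩ M) (θ P) →
                        ⟦⟧._≈_ Q A (interpret Q A ⟨$⟩ M) (θ Q)
  profinite-definable A θ profinite M M≈θ = ⟦⟧.trans Q A
    (⟦⟧.sym Q A (related⇒retract A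
      (⟦⟧ᴿ-resp-≈ {P} {Q} Graph A M≈θ (⟦⟧.refl Q A)
        (interpret-⟦⟧ᴿ {P} {Q} Graph A M))))
    (related⇒retract A (profinite P Q Graph graph-isPartialSurjection))

profinite⇒parametric : (A : Ty) (θ : (Q : FiniteSet) → ⟦ A ⟧∙ Q) →
                       (∀ Q → θ Q ∈ D Q A) →
                       IsProfinite A θ → IsParametric A θ
profinite⇒parametric A θ definable profinite Q Q′ R
  with inhabited⊎empty Q | inhabited⊎empty Q′
... | _       | inj₂ ¬q′ =
  profinite Q Q′ R (into-empty-isPartialSurjection ¬q′ R)
-- Profiniteness is applied from `Q′` to the empty `Q`; flipping twice returns `R` definitionally.
... | inj₂ ¬q | inj₁ _   =
  ⟦⟧ᴿ-flip A {Q′} {Q}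
    (profinite Q′ Q (flip R) (into-empty-isPartialSurjection ¬q (flip R)))
... | inj₁ q₀ | inj₁ q₀′ with definable (Q ×ᶠ Q′)
...   | M , M≈θ =
  ⟦⟧ᴿ-resp-≈ {Q} {Q′} R A
    (Onto-Q.profinite-definable A θ profinite M M≈θ)
    (Onto-Q′.profinite-definable A θ profinite M M≈θ)
    (interpret-⟦⟧ᴿ {Q} {Q′} R A M)
  where
  -- Each projection is split by pairing with a fixed point of the other factor; this is where
  -- inhabitedness enters.
  module Onto-Q  = Retraction {Q ×ᶠ Q′} {Q}  proj₁ (_, q₀′) (λ _ → refl)
  module Onto-Q′ = Retraction {Q ×ᶠ Q′} {Q′} proj₂ (q₀ ,_)  (λ _ → refl)

theoremB : (A : Ty) (θ : (Q : FiniteSet) → ⟦ A ⟧∙ Q) →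
    (∀ Q → θ Q ∈ D Q A) →
    IsProfinite A θ ⇔ IsParametric A θ
theoremB A θ definable = mk⇔
  (profinite⇒parametric A θ definable)
  (λ parametric Q Q′ f _ → parametric Q Q′ f)
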